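{- The sufficient condition "$2\alpha+\beta\ge W$" for the existence of an optimal 2WCST rooted at an equal-to test (where $\alpha\ge\beta$ are the two heaviest key weights and $W$ is the total weight) is tight for $\alpha<\tfrac25$, in the following sense. Let $\alpha<\tfrac25$ and $\beta\le\alpha$ be real numbers with $2\alpha+\beta=1$. Then for all sufficiently small $\epsilon>0$ there is an instance with total weight $1$, whose heaviest key weight is $\alpha$ and whose second heaviest key weight is $\beta-\epsilon$, such that no optimal 2WCST for this instance is rooted at an equal-to test.
   Context: An instance is a finite linearly ordered set $\mathcal K$ of $n$ keys, each key $k$ having a weight $w_k\ge 0$. A two-way comparison search tree (2WCST) for $\mathcal K$ is a rooted binary decision tree whose leaves are in bijection with the keys of $\mathcal K$ and in which each internal node is labelled either with an equal-to test $\langle =k\rangle$ ("is $q=k$?") or a less-than test $\langle <k\rangle$ ("is $q<k$?") for a key $k\in\mathcal K$, and has two children, one for the answer "yes" and one for the answer "no". It is required that for each query $q\in\mathcal K$, the search starting at the root ends in the leaf labelled $q$. The cost of $T$ is $\sum_{k}w_k\cdot \mathrm{depth}(k)$, where $\mathrm{depth}(k)$ is the number of comparison nodes on the path from the root to leaf $k$; $T$ is optimal if its cost is minimum among all 2WCSTs for the instance. The first and second heaviest weights are counted with multiplicity. -}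

module Defs where

open import Algebra.Bundles.Raw using (RawMonoid)
open import Data.Bool.Base using (Bool; if_then_else_)
open import Data.Fin.Base using (Fin)
import Data.Fin.Properties as Fin
open import Data.Nat.Base as ℕ using (ℕ; suc)
import Data.Nat.Properties as ℕ
open import Data.Product using (∃; ∃₂; _×_; _,_)
open import Data.Rational.Base as ℚ using (ℚ; 0ℚ; 1ℚ; ½; ∣_∣)
import Data.Rational.Properties as ℚ
open import Data.Rational.Solver using (module +-*-Solver)
open import Function.Bundles using (_↔_; module Inverse)
open import Level using (0ℓ)
open import Relation.Binary.PropositionalEquality
  using (_≡_; _≢_; refl; sym; trans; cong; subst)
open import Relation.Nullary using (does)

------------------------------------------------------------------------
-- Real numbers: Cauchy sequences of rationals, with equality _≈_

record ℝ : Set where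
  field
    seq    : ℕ → ℚ
    cauchy : ∀ δ → 0ℚ ℚ.< δ →
             ∃ λ N → ∀ m n → N ℕ.≤ m → N ℕ.≤ n → ∣ seq m ℚ.- seq n ∣ ℚ.< δ

open ℝ public

infix 4 _≈_ _≤_ _<_

_≈_ : ℝ → ℝ → Set
x ≈ y = ∀ δ → 0ℚ ℚ.< δ →
        ∃ λ N → ∀ n → N ℕ.≤ n → ∣ seq x n ℚ.- seq y n ∣ ℚ.< δ

-- Termwise comparison of the sequences would not respect _≈_: the slack δ
-- is needed in both orders.

_≤_ : ℝ → ℝ → Set
x ≤ y = ∀ δ → 0ℚ ℚ.< δ →
        ∃ λ N → ∀ n → N ℕ.≤ n → seq x n ℚ.< seq y n ℚ.+ δ

_<_ : ℝ → ℝ → Set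
x < y = ∃ λ δ → 0ℚ ℚ.< δ ×
        ∃ λ N → ∀ n → N ℕ.≤ n → seq x n ℚ.+ δ ℚ.< seq y n

fromℚ : ℚ → ℝ
fromℚ q .seq _ = q
fromℚ q .cauchy δ 0<δ =
  0 , λ _ _ _ _ → subst (ℚ._< δ) (sym (cong ∣_∣ (ℚ.+-inverseʳ q))) 0<δ

0ℝ 1ℝ : ℝ
0ℝ = fromℚ 0ℚ
1ℝ = fromℚ 1ℚ

infixl 6 _+_ _-_
infix  8 -_

private
  half-pos : ∀ {δ} → 0ℚ ℚ.< δ → 0ℚ ℚ.< ½ ℚ.* δ
  half-pos {δ} 0<δ =
    subst (ℚ._< ½ ℚ.* δ) (ℚ.*-zeroʳ ½) (ℚ.*-monoʳ-<-pos ½ 0<δ)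

  half+half : ∀ δ → ½ ℚ.* δ ℚ.+ ½ ℚ.* δ ≡ δ
  half+half δ = trans (sym (ℚ.*-distribʳ-+ δ ½ ½)) (ℚ.*-identityˡ δ)

  sum-diff : ∀ a b c d →
             (a ℚ.+ b) ℚ.- (c ℚ.+ d) ≡ (a ℚ.- c) ℚ.+ (b ℚ.- d)
  sum-diff = solve 4 (λ a b c d → (a :+ b) :- (c :+ d) := (a :- c) :+ (b :- d)) refl
    where open +-*-Solver

  neg-diff : ∀ a b → (ℚ.- a) ℚ.- (ℚ.- b) ≡ ℚ.- (a ℚ.- b)
  neg-diff a b = sym (ℚ.neg-distrib-+ a (ℚ.- b))

_+_ : ℝ → ℝ → ℝ
(x + y) .seq n = seq x n ℚ.+ seq y n
(x + y) .cauchy δ 0<δ with cauchy x (½ ℚ.* δ) (half-pos 0<δ)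
                         | cauchy y (½ ℚ.* δ) (half-pos 0<δ)
... | M , x-close | N , y-close = M ℕ.⊔ N , close
  where
  open ℚ.≤-Reasoning
  close : ∀ m n → M ℕ.⊔ N ℕ.≤ m → M ℕ.⊔ N ℕ.≤ n →
          ∣ (seq x m ℚ.+ seq y m) ℚ.- (seq x n ℚ.+ seq y n) ∣ ℚ.< δ
  close m n ≤m ≤n = begin-strict
    ∣ (seq x m ℚ.+ seq y m) ℚ.- (seq x n ℚ.+ seq y n) ∣
      ≡⟨ cong ∣_∣ (sum-diff (seq x m) (seq y m) (seq x n) (seq y n)) ⟩
    ∣ (seq x m ℚ.- seq x n) ℚ.+ (seq y m ℚ.- seq y n) ∣
      ≤⟨ ℚ.∣p+q∣≤∣p∣+∣q∣ (seq x m ℚ.- seq x n) (seq y m ℚ.- seq y n) ⟩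
    ∣ seq x m ℚ.- seq x n ∣ ℚ.+ ∣ seq y m ℚ.- seq y n ∣
      <⟨ ℚ.+-mono-< (x-close m n (ℕ.m⊔n≤o⇒m≤o M N ≤m) (ℕ.m⊔n≤o⇒m≤o M N ≤n))
                    (y-close m n (ℕ.m⊔n≤o⇒n≤o M N ≤m) (ℕ.m⊔n≤o⇒n≤o M N ≤n)) ⟩
    ½ ℚ.* δ ℚ.+ ½ ℚ.* δ
      ≡⟨ half+half δ ⟩
    δ ∎

-_ : ℝ → ℝ
(- x) .seq n = ℚ.- seq x n
(- x) .cauchy δ 0<δ with cauchy x δ 0<δ
... | N , close = N , λ m n N≤m N≤n →
  subst (ℚ._< δ)
        (sym (trans (cong ∣_∣ (neg-diff (seq x m) (seq x n)))
                    (ℚ.∣-p∣≡∣p∣ (seq x m ℚ.- seq x n))))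
        (close m n N≤m N≤n)

_-_ : ℝ → ℝ → ℝ
x - y = x + (- y)

+-rawMonoid : RawMonoid 0ℓ 0ℓ
+-rawMonoid = record { Carrier = ℝ ; _≈_ = _≈_ ; _∙_ = _+_ ; ε = 0ℝ }

-- n · x is the natural multiple x + ⋯ + x; the only real products needed
-- are depth · weight and 2α.
open import Algebra.Definitions.RawMonoid +-rawMonoid public
  using (sum) renaming (_×_ to _·_)

------------------------------------------------------------------------
-- Instances

-- The keys are Fin n with its usual order, which is up to isomorphism the
-- only linear order with n elements.

record Instance : Set where
  field
    n      : ℕ
    weight : Fin n → ℝ
    nonneg : ∀ k → 0ℝ ≤ weight k

  totalWeight : ℝ
  totalWeight = sum weight

-- The two keys i and j are distinct but may have equal weights, so weights
-- are counted with multiplicity.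

HeaviestTwo : Instance → ℝ → ℝ → Set
HeaviestTwo I a b = ∃₂ λ i j →
  i ≢ j ×
  weight i ≈ a ×
  weight j ≈ b ×
  (∀ k → weight k ≤ weight i) ×
  (∀ k → k ≢ i → weight k ≤ weight j)
  where open Instance I

------------------------------------------------------------------------
-- Two-way comparison search trees

data Test (n : ℕ) : Set where
  equalTo  : Fin n → Test n
  lessThan : Fin n → Test n

answer : ∀ {n} → Test n → Fin n → Bool
answer (equalTo k)  q = does (q Fin.≟ k)
answer (lessThan k) q = does (q Fin.<? k)

data DecisionTree (n : ℕ) : Set where
  leaf : DecisionTree n
  node : (test : Test n) (yes no : DecisionTree n) → DecisionTree n

-- The leaves of a tree, each given by its path from the root.
data Leaf {n : ℕ} : DecisionTree n → Set where
  here  : Leaf leaf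
  inYes : ∀ {test yes no} → Leaf yes → Leaf (node test yes no)
  inNo  : ∀ {test yes no} → Leaf no  → Leaf (node test yes no)

leafDepth : ∀ {n} {t : DecisionTree n} → Leaf t → ℕ
leafDepth here      = 0
leafDepth (inYes l) = suc (leafDepth l)
leafDepth (inNo l)  = suc (leafDepth l)

search : ∀ {n} (t : DecisionTree n) → Fin n → Leaf t
search leaf                 q = here
search (node test yes no) q =
  if answer test q then inYes (search yes q) else inNo (search no q)

record 2WCST (n : ℕ) : Set where
  field
    tree     : DecisionTree n
    labels   : Leaf tree ↔ Fin n
    searches : ∀ q → Inverse.to labels (search tree q) ≡ q

  depth : Fin n → ℕ
  depth k = leafDepth (Inverse.from labels k)

data RootedAtEqualTo {n : ℕ} : DecisionTree n → Set where
  rooted : ∀ {k yes no} → RootedAtEqualTo (node (equalTo k) yes no)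

module _ (I : Instance) where
  open Instance I

  cost : 2WCST n → ℝ
  cost T = sum λ k → 2WCST.depth T k · weight k

  Optimal : 2WCST n → Set
  Optimal T = ∀ T′ → cost T ≤ cost T′

{-# OPTIONS --safe #-}
module Submission where

-- Put b = β - ε and give four keys, in this order, the weights α, b, b and
-- α - β + 2ε; their sum is 2α + β = 1. If ε is small enough that α + ε ≤ 2/5,
-- then the last weight is at most b. The balanced tree has cost 2.
-- Below a root ⟨= k⟩ the "no" subtree holds all the other keys, of which there
-- are at least three, so at most one of them, m say, has depth 2. Hence the cost
-- is at least 3 - 2 w k - w m ≥ 3 - 2α - b = 2 + ε.

open import Defs
open import Algebra.Bundles using (CommutativeMonoid)
import Algebra.Properties.CommutativeMonoid.Sum as Sum
open import Data.Bool.Base using (if_then_else_)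
open import Data.Empty using (⊥)
open import Data.Fin.Base using (Fin; zero; suc; punchIn)
import Data.Fin.Properties as Fin
open import Data.Integer.Base using (+_)
open import Data.Nat.Base as ℕ using (ℕ; zero; suc; z≤n; s≤s)
import Data.Nat.Properties as ℕ
open import Data.Product using (∃; ∃₂; _×_; _,_)
open import Data.Rational.Base as ℚ using (0ℚ; ½; _/_; ∣_∣)
import Data.Rational.Properties as ℚ
open import Data.Rational.Solver using (module +-*-Solver)
open import Data.Sum.Base using (inj₁; inj₂)
open import Function.Base using (_∘_)
open import Function.Bundles using (module Inverse; mk↔ₛ′)
open import Function.Definitions using (Injective)
open import Level using (0ℓ)
open import Relation.Binary.Bundles using (Preorder)
open import Relation.Binary.PropositionalEquality
  using (_≡_; _≢_; refl; sym; trans; cong; cong₂; subst)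
open import Relation.Nullary using (¬_; yes; no; contradiction)
open import Relation.Nullary.Decidable using (dec-false)

open +-*-Solver using (Polynomial; solve; _:=_; _:+_; _:-_; :-_; con)

infixr 8 _:·_
-- The solver's counterpart of `_·_`, unfolding to the same iterated sum so that `refl` closes
-- identities with multiples.
_:·_ : ∀ {n} → ℕ → Polynomial n → Polynomial n
zero  :· p = con 0ℚ
suc n :· p = p :+ n :· p

-- Order on the reals

private
  variable
    u x y z : ℝ

-- The equation ends in the variable `δ`, so matching it with `refl` replaces a tolerance by
-- `η + η`.
halve : ∀ δ → 0ℚ ℚ.< δ → ∃ λ η → 0ℚ ℚ.< η × η ℚ.+ η ≡ δ
halve δ 0<δ =
  ½ ℚ.* δ ,
  subst (ℚ._< ½ ℚ.* δ) (ℚ.*-zeroʳ ½) (ℚ.*-monoʳ-<-pos ½ 0<δ) ,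
  trans (sym (ℚ.*-distribʳ-+ δ ½ ½)) (ℚ.*-identityˡ δ)

p≤∣p∣ : ∀ p → p ℚ.≤ ∣ p ∣
p≤∣p∣ p with ℚ.≤-total 0ℚ p
... | inj₁ 0≤p = ℚ.≤-reflexive (sym (ℚ.0≤p⇒∣p∣≡p 0≤p))
... | inj₂ p≤0 = ℚ.≤-trans p≤0 (ℚ.0≤∣p∣ p)

p<p+q : ∀ p {q} → 0ℚ ℚ.< q → p ℚ.< p ℚ.+ q
p<p+q p {q} 0<q =
  subst (ℚ._< p ℚ.+ q) (ℚ.+-identityʳ p) (ℚ.+-monoʳ-< p 0<q)

-- _≈_ itself is never needed as a congruence: all identities hold termwise.

infix 4 _≋_
_≋_ : ℝ → ℝ → Set
x ≋ y = ∀ n → seq x n ≡ seq y n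

-- Makes `sum-remove` available for `sum`, whose definition depends only on `_+_` and `0ℝ`, not on
-- the choice of equality.
+-commutativeMonoid : CommutativeMonoid 0ℓ 0ℓ
+-commutativeMonoid = record
  { Carrier = ℝ
  ; _≈_     = _≋_
  ; _∙_     = _+_
  ; ε       = 0ℝ
  ; isCommutativeMonoid = record
    { isMonoid = record
      { isSemigroup = record
        { isMagma = record
          { isEquivalence = record
            { refl  = λ _ → refl
            ; sym   = λ x≋y n → sym (x≋y n)
            ; trans = λ x≋y y≋z n → trans (x≋y n) (y≋z n)
            }
          ; ∙-cong = λ x≋y u≋v n → cong₂ ℚ._+_ (x≋y n) (u≋v n)
          }
        ; assoc = λ x y z n → ℚ.+-assoc (seq x n) (seq y n) (seq z n)
        }
      ; identity = (λ x n → ℚ.+-identityˡ (seq x n))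
                 , (λ x n → ℚ.+-identityʳ (seq x n))
      }
    ; comm = λ x y n → ℚ.+-comm (seq x n) (seq y n)
    }
  }

open CommutativeMonoid +-commutativeMonoid
  using (isEquivalence)
  renaming (refl to ≋-refl)
open Sum +-commutativeMonoid using (sum-remove)

≋-≈-trans : x ≋ y → y ≈ z → x ≈ z
≋-≈-trans {z = z} x≋y y≈z δ 0<δ with y≈z δ 0<δ
... | N , close = N , λ n N≤n →
  subst (λ p → ∣ p ℚ.- seq z n ∣ ℚ.< δ) (sym (x≋y n)) (close n N≤n)

≈-refl : x ≈ x
≈-refl {x} δ 0<δ = 0 , λ n _ →
  subst (ℚ._< δ) (sym (cong ∣_∣ (ℚ.+-inverseʳ (seq x n)))) 0<δ

≋⇒≤ : x ≋ y → x ≤ y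
≋⇒≤ {x} x≋y δ 0<δ = 0 , λ n _ →
  subst (λ p → seq x n ℚ.< p ℚ.+ δ) (x≋y n) (p<p+q (seq x n) 0<δ)

≤-refl : x ≤ x
≤-refl {x} = ≋⇒≤ {x} {x} (≋-refl {x})

≤-trans : x ≤ y → y ≤ z → x ≤ z
≤-trans {x} {y} {z} x≤y y≤z δ 0<δ with halve δ 0<δ
... | η , 0<η , refl with x≤y η 0<η | y≤z η 0<η
... | M , x<y+η | N , y<z+η = M ℕ.⊔ N , λ n ≤n → begin-strict
  seq x n                  <⟨ x<y+η n (ℕ.m⊔n≤o⇒m≤o M N ≤n) ⟩
  seq y n ℚ.+ η            <⟨ ℚ.+-monoˡ-< η (y<z+η n (ℕ.m⊔n≤o⇒n≤o M N ≤n)) ⟩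
  seq z n ℚ.+ η ℚ.+ η      ≡⟨ ℚ.+-assoc (seq z n) η η ⟩
  seq z n ℚ.+ (η ℚ.+ η)    ∎
  where open ℚ.≤-Reasoning

+-mono-≤ : u ≤ x → y ≤ z → u + y ≤ x + z
+-mono-≤ {u} {x} {y} {z} u≤x y≤z δ 0<δ with halve δ 0<δ
... | η , 0<η , refl with u≤x η 0<η | y≤z η 0<η
... | M , u<x+η | N , y<z+η = M ℕ.⊔ N , λ n ≤n → begin-strict
  seq u n ℚ.+ seq y n
    <⟨ ℚ.+-mono-< (u<x+η n (ℕ.m⊔n≤o⇒m≤o M N ≤n)) (y<z+η n (ℕ.m⊔n≤o⇒n≤o M N ≤n)) ⟩
  (seq x n ℚ.+ η) ℚ.+ (seq z n ℚ.+ η)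
    ≡⟨ solve 3 (λ p q r → (p :+ r) :+ (q :+ r) := (p :+ q) :+ (r :+ r)) refl
             (seq x n) (seq z n) η ⟩
  (seq x n ℚ.+ seq z n) ℚ.+ (η ℚ.+ η) ∎
  where open ℚ.≤-Reasoning

-- Replaces moving terms across an inequality: the weights are compared below after adding a
-- suitable term to both sides.
+-cancelʳ-≤ : ∀ z → x + z ≤ y + z → x ≤ y
+-cancelʳ-≤ {x} {y} z x+z≤y+z δ 0<δ with x+z≤y+z δ 0<δ
... | N , x+z<y+z+δ = N , λ n N≤n → begin-strict
  seq x n
    ≡⟨ solve 2 (λ p r → p := (p :+ r) :- r) refl (seq x n) (seq z n) ⟩
  (seq x n ℚ.+ seq z n) ℚ.- seq z n
    <⟨ ℚ.+-monoˡ-< (ℚ.- seq z n) (x+z<y+z+δ n N≤n) ⟩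
  ((seq y n ℚ.+ seq z n) ℚ.+ δ) ℚ.- seq z n
    ≡⟨ solve 3 (λ q r d → ((q :+ r) :+ d) :- r := q :+ d) refl
             (seq y n) (seq z n) δ ⟩
  seq y n ℚ.+ δ ∎
  where open ℚ.≤-Reasoning

<⇒≤ : x < y → x ≤ y
<⇒≤ {x} {y} (d , 0<d , N , x+d<y) δ 0<δ = N , λ n N≤n → ℚ.<-trans
  (p<p+q (seq x n) 0<d) (ℚ.<-trans (x+d<y n N≤n) (p<p+q (seq y n) 0<δ))

-- The gap `δ` witnessing `x < y` becomes the tolerance in `y ≤ x`; at index `M ⊔ N` the two
-- estimates clash.
<⇒≱ : x < y → ¬ (y ≤ x)
<⇒≱ {x} {y} (δ , 0<δ , M , x+δ<y) y≤x with y≤x δ 0<δ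
... | N , y<x+δ = ℚ.<-irrefl refl
  (ℚ.<-trans (y<x+δ (M ℕ.⊔ N) (ℕ.m≤n⊔m M N)) (x+δ<y (M ℕ.⊔ N) (ℕ.m≤m⊔n M N)))

≈⇒≥ : x ≈ y → y ≤ x
≈⇒≥ {x} {y} x≈y δ 0<δ with x≈y δ 0<δ
... | N , close = N , λ n N≤n → begin-strict
  seq y n
    ≡⟨ solve 2 (λ p q → q := p :+ (q :- p)) refl (seq x n) (seq y n) ⟩
  seq x n ℚ.+ (seq y n ℚ.- seq x n)
    ≤⟨ ℚ.+-monoʳ-≤ (seq x n) (p≤∣p∣ (seq y n ℚ.- seq x n)) ⟩
  seq x n ℚ.+ ∣ seq y n ℚ.- seq x n ∣
    ≡⟨ cong (λ p → seq x n ℚ.+ ∣ p ∣)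
            (solve 2 (λ p q → q :- p := :- (p :- q)) refl (seq x n) (seq y n)) ⟩
  seq x n ℚ.+ ∣ ℚ.- (seq x n ℚ.- seq y n) ∣
    ≡⟨ cong (seq x n ℚ.+_) (ℚ.∣-p∣≡∣p∣ (seq x n ℚ.- seq y n)) ⟩
  seq x n ℚ.+ ∣ seq x n ℚ.- seq y n ∣
    <⟨ ℚ.+-monoʳ-< (seq x n) (close n N≤n) ⟩
  seq x n ℚ.+ δ ∎
  where open ℚ.≤-Reasoning

≤-preorder : Preorder 0ℓ 0ℓ 0ℓ
≤-preorder = record
  { Carrier    = ℝ
  ; _≈_        = _≋_
  ; _≲_        = _≤_
  ; isPreorder = record
    { isEquivalence = isEquivalence
    ; reflexive     = λ {x} {y} → ≋⇒≤ {x} {y}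
    ; trans         = λ {x} {y} {z} → ≤-trans {x} {y} {z}
    }
  }

open import Relation.Binary.Reasoning.Preorder ≤-preorder

-- Monotonicity of multiples and finite sums

·-monoʳ-≤ : ∀ n → x ≤ y → n · x ≤ n · y
·-monoʳ-≤         zero    x≤y = ≤-refl {0ℝ}
·-monoʳ-≤ {x} {y} (suc n) x≤y =
  +-mono-≤ {x} {y} {n · x} {n · y} x≤y (·-monoʳ-≤ {x} {y} n x≤y)

·-nonneg : ∀ n → 0ℝ ≤ x → 0ℝ ≤ n · x
·-nonneg     zero    0≤x = ≤-refl {0ℝ}
·-nonneg {x} (suc n) 0≤x =
  +-mono-≤ {0ℝ} {x} {0ℝ} {n · x} 0≤x (·-nonneg {x} n 0≤x)

·-monoˡ-≤ : ∀ {m n} → 0ℝ ≤ x → m ℕ.≤ n → m · x ≤ n · x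
·-monoˡ-≤ {x} {n = n} 0≤x z≤n = ·-nonneg {x} n 0≤x
·-monoˡ-≤ {x} {suc m} {suc n} 0≤x (s≤s m≤n) =
  +-mono-≤ {x} {x} {m · x} {n · x} (≤-refl {x}) (·-monoˡ-≤ {x} 0≤x m≤n)

sum-mono-≤ : ∀ {n} (f g : Fin n → ℝ) → (∀ i → f i ≤ g i) → sum f ≤ sum g
sum-mono-≤ {zero}  f g f≤g = ≤-refl {0ℝ}
sum-mono-≤ {suc n} f g f≤g =
  +-mono-≤ {f zero} {g zero} {sum (f ∘ suc)} {sum (g ∘ suc)}
    (f≤g zero) (sum-mono-≤ (f ∘ suc) (g ∘ suc) (f≤g ∘ suc))

-- Depths below an equal-to root

twoLeaves : ∀ {n} {test : Test n} →
  ∃ λ (g : Leaf (node test leaf leaf) → Fin 2) → Injective _≡_ _≡_ g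
twoLeaves =
  (λ { (inYes here) → zero ; (inNo here) → suc zero }) ,
  λ { {inYes here} {inYes here} _ → refl ; {inNo here} {inNo here} _ → refl
    ; {inYes here} {inNo here} () ; {inNo here} {inYes here} () }

-- A leaf of depth 0 is the whole tree, and two distinct leaves of depth 1 must be the two children
-- of the root. An injection into `Fin 2` is the form that the pigeonhole principle refutes.
shallow⇒fewLeaves : ∀ {n} {t : DecisionTree n} (l₁ l₂ : Leaf t) → l₁ ≢ l₂ →
  leafDepth l₁ ℕ.≤ 1 → leafDepth l₂ ℕ.≤ 1 →
  ∃ λ (g : Leaf t → Fin 2) → Injective _≡_ _≡_ g
shallow⇒fewLeaves here here l₁≢l₂ _ _ = contradiction refl l₁≢l₂
shallow⇒fewLeaves (inYes here) (inYes here) l₁≢l₂ _ _ = contradiction refl l₁≢l₂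
shallow⇒fewLeaves (inNo here)  (inNo here)  l₁≢l₂ _ _ = contradiction refl l₁≢l₂
shallow⇒fewLeaves (inYes here) (inNo here)  _ _ _ = twoLeaves
shallow⇒fewLeaves (inNo here)  (inYes here) _ _ _ = twoLeaves
shallow⇒fewLeaves (inYes (inYes _)) _ _ (s≤s ()) _
shallow⇒fewLeaves (inYes (inNo _))  _ _ (s≤s ()) _
shallow⇒fewLeaves (inNo (inYes _))  _ _ (s≤s ()) _
shallow⇒fewLeaves (inNo (inNo _))   _ _ (s≤s ()) _
shallow⇒fewLeaves (inYes here) (inNo (inYes _))  _ _ (s≤s ())
shallow⇒fewLeaves (inYes here) (inNo (inNo _))   _ _ (s≤s ())
shallow⇒fewLeaves (inNo here)  (inYes (inYes _)) _ _ (s≤s ())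
shallow⇒fewLeaves (inNo here)  (inYes (inNo _))  _ _ (s≤s ())

-- Applied with `t` the "no" subtree and `f` sending each key other than the root's to its leaf.
module _ {N n} {t : DecisionTree N} (f : Fin (3 ℕ.+ n) → Leaf t)
         (f-injective : Injective _≡_ _≡_ f) where

  many⇒notFew : ¬ ∃ λ (g : Leaf t → Fin 2) → Injective _≡_ _≡_ g
  many⇒notFew (g , g-injective)
    with Fin.pigeonhole (s≤s (s≤s (s≤s z≤n))) (g ∘ f)
  ... | i , j , i<j , gfi≡gfj =
    Fin.<⇒≢ i<j (f-injective (g-injective gfi≡gfj))

  shallow-unique : ∀ i j → i ≢ j → leafDepth (f i) ℕ.≤ 1 → 1 ℕ.< leafDepth (f j)
  shallow-unique i j i≢j dᵢ≤1 = ℕ.≰⇒> λ dⱼ≤1 →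
    many⇒notFew (shallow⇒fewLeaves (f i) (f j) (i≢j ∘ f-injective) dᵢ≤1 dⱼ≤1)

  -- Depth 0 would make `t` a single leaf, on which `f` cannot separate `zero` from `suc zero`.
  leafDepth-positive : ∀ i → 0 ℕ.< leafDepth (f i)
  leafDepth-positive i with f i in fᵢ
  ... | inYes _ = s≤s z≤n
  ... | inNo  _ = s≤s z≤n
  ... | here    = contradiction
    (f-injective {zero} {suc zero} (trans (only (f zero)) (sym (only (f (suc zero))))))
    λ ()
    where
    only : (l : Leaf leaf) → l ≡ here
    only here = refl

  allButOne-deep : ∃ λ m → ∀ j → 1 ℕ.< leafDepth (f (punchIn m j))
  allButOne-deep with Fin.any? (λ m → leafDepth (f m) ℕ.≤? 1)
  ... | yes (m , dₘ≤1) = m , λ j →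
    shallow-unique m (punchIn m j) (Fin.punchInᵢ≢i m j ∘ sym) dₘ≤1
  -- No index is shallow, so the exception `zero` is an arbitrary choice.
  ... | no none = zero , λ j → ℕ.≰⇒> λ d≤1 → none (suc j , d≤1)

-- The keys other than `k` fail the root test, so these three or more keys reach distinct leaves of
-- the "no" subtree, and the root adds 1 to each depth there. `punchIn k` enumerates these keys;
-- composed with `punchIn m` it skips the one exception as well.
depths-below-equalTo : ∀ {n} (T : 2WCST (4 ℕ.+ n)) → RootedAtEqualTo (2WCST.tree T) →
  ∃₂ λ k m → 1 ℕ.≤ 2WCST.depth T k × 2 ℕ.≤ 2WCST.depth T (punchIn k m) ×
             (∀ j → 3 ℕ.≤ 2WCST.depth T (punchIn k (punchIn m j)))
depths-below-equalTo {n}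
  record { tree = node (equalTo k) tʸ tⁿ ; labels = labels ; searches = searches } rooted
  = let m , deep = allButOne-deep noLeaf noLeaf-injective in
    k , m , positive (from k) ,
    below m (leafDepth-positive noLeaf noLeaf-injective m) ,
    λ j → below (punchIn m j) (deep j)
  where
  open Inverse labels

  t : DecisionTree (4 ℕ.+ n)
  t = node (equalTo k) tʸ tⁿ

  noLeaf : Fin (3 ℕ.+ n) → Leaf tⁿ
  noLeaf j = search tⁿ (punchIn k j)

  positive : (l : Leaf t) → 1 ℕ.≤ leafDepth l
  positive (inYes _) = s≤s z≤n
  positive (inNo  _) = s≤s z≤n

  search-punchIn : ∀ j → search t (punchIn k j) ≡ inNo (noLeaf j)
  search-punchIn j =
    cong (λ b → if b then inYes (search tʸ (punchIn k j)) else inNo (noLeaf j))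
         (dec-false (punchIn k j Fin.≟ k) (Fin.punchInᵢ≢i k j))

  to-noLeaf : ∀ j → to (inNo (noLeaf j)) ≡ punchIn k j
  to-noLeaf j = trans (cong to (sym (search-punchIn j))) (searches (punchIn k j))

  -- A leaf has only one label, so keys whose searches end in the same leaf coincide.
  noLeaf-injective : Injective _≡_ _≡_ noLeaf
  noLeaf-injective {i} {j} eq = Fin.punchIn-injective k i j
    (trans (sym (to-noLeaf i)) (trans (cong (to ∘ inNo) eq) (to-noLeaf j)))

  -- Connects the leaf found by the search with `from`, through which `depth` is defined.
  from-punchIn : ∀ j → from (punchIn k j) ≡ inNo (noLeaf j)
  from-punchIn j = trans (cong from (sym (to-noLeaf j))) (strictlyInverseʳ _)

  below : ∀ {d} j → d ℕ.≤ leafDepth (noLeaf j) →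
          suc d ℕ.≤ leafDepth (from (punchIn k j))
  below {d} j d≤ =
    subst (λ l → suc d ℕ.≤ leafDepth l) (sym (from-punchIn j)) (s≤s d≤)

-- Lower bound on the cost under an equal-to root

sum-split : ∀ {n} (f : Fin (2 ℕ.+ n) → ℝ) k m →
  sum f ≋ f k + (f (punchIn k m) + sum (λ j → f (punchIn k (punchIn m j))))
sum-split f k m i = trans (sum-remove {i = k} f i)
  (cong (seq (f k) i ℚ.+_) (sum-remove {i = m} (f ∘ punchIn k) i))

-- Compared with depth 3, depth 1 saves two copies of a weight and depth 2 saves one; `2 · x + y`
-- collects these savings.
regroup : ∀ x y z → 3 · x + (3 · y + z) ≋ (1 · x + (2 · y + z)) + (2 · x + y)
regroup x y z i = solve 3
  (λ x y z → 3 :· x :+ (3 :· y :+ z) := (1 :· x :+ (2 :· y :+ z)) :+ (2 :· x :+ y))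
  refl (seq x i) (seq y i) (seq z i)

regroup-≤ : ∀ x y {x′ y′ z z′} → 1 · x ≤ x′ → 2 · y ≤ y′ → z ≤ z′ →
  3 · x + (3 · y + z) ≤ (x′ + (y′ + z′)) + (2 · x + y)
regroup-≤ x y {x′} {y′} {z} {z′} x≤ y≤ z≤ = begin
  3 · x + (3 · y + z)
    ≈⟨ regroup x y z ⟩
  (1 · x + (2 · y + z)) + (2 · x + y)
    ≲⟨ +-mono-≤ {1 · x + (2 · y + z)} {x′ + (y′ + z′)} {2 · x + y} {2 · x + y}
         (+-mono-≤ {1 · x} {x′} {2 · y + z} {y′ + z′} x≤
           (+-mono-≤ {2 · y} {y′} {z} {z′} y≤ z≤))
         (≤-refl {2 · x + y}) ⟩
  (x′ + (y′ + z′)) + (2 · x + y) ∎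

-- The left side places every key at depth 3. Only `k` and `punchIn k m` can lie higher, and the
-- last summand bounds what they save.
sum-bound : ∀ {n} (w : Fin (2 ℕ.+ n) → ℝ) → (∀ j → 0ℝ ≤ w j) →
  (d : Fin (2 ℕ.+ n) → ℕ) → ∀ k m →
  1 ℕ.≤ d k → 2 ℕ.≤ d (punchIn k m) → (∀ j → 3 ℕ.≤ d (punchIn k (punchIn m j))) →
  sum (λ j → 3 · w j) ≤ sum (λ j → d j · w j) + (2 · w k + w (punchIn k m))
sum-bound w 0≤w d k m dₖ≥1 dₘ≥2 d≥3 = begin
  sum (λ j → 3 · w j)
    ≈⟨ sum-split (λ j → 3 · w j) k m ⟩
  3 · w k + (3 · w (punchIn k m) + sum (λ j → 3 · w (punchIn k (punchIn m j))))
    ≲⟨ regroup-≤ (w k) (w (punchIn k m))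
         {d k · w k} {d (punchIn k m) · w (punchIn k m)}
         {sum (λ j → 3 · w (punchIn k (punchIn m j)))}
         {sum (λ j → d (punchIn k (punchIn m j)) · w (punchIn k (punchIn m j)))}
         (·-monoˡ-≤ {w k} (0≤w k) dₖ≥1)
         (·-monoˡ-≤ {w (punchIn k m)} (0≤w (punchIn k m)) dₘ≥2)
         (sum-mono-≤ (λ j → 3 · w (punchIn k (punchIn m j)))
           (λ j → d (punchIn k (punchIn m j)) · w (punchIn k (punchIn m j)))
           λ j → ·-monoˡ-≤ {w (punchIn k (punchIn m j))} (0≤w _) (d≥3 j)) ⟩
  (d k · w k + (d (punchIn k m) · w (punchIn k m)
    + sum (λ j → d (punchIn k (punchIn m j)) · w (punchIn k (punchIn m j)))))
    + (2 · w k + w (punchIn k m))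
    ≈⟨ (λ i → cong (ℚ._+ seq (2 · w k + w (punchIn k m)) i)
                   (sum-split (λ j → d j · w j) k m i)) ⟨
  sum (λ j → d j · w j) + (2 · w k + w (punchIn k m)) ∎

equalToRoot-cost : ∀ {n} (w : Fin (4 ℕ.+ n) → ℝ) → (∀ j → 0ℝ ≤ w j) →
  (T : 2WCST (4 ℕ.+ n)) → RootedAtEqualTo (2WCST.tree T) →
  ∃₂ λ k m → k ≢ m ×
    sum (λ j → 3 · w j) ≤ sum (λ j → 2WCST.depth T j · w j) + (2 · w k + w m)
equalToRoot-cost w 0≤w T root =
  let k , m , dₖ≥1 , dₘ≥2 , d≥3 = depths-below-equalTo T root in
  k , punchIn k m , Fin.punchInᵢ≢i k m ∘ sym ,
  sum-bound w 0≤w (2WCST.depth T) k m dₖ≥1 dₘ≥2 d≥3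

-- If `k` is `i`, then `m` is not, and `w m ≤ w j`. Otherwise one copy of `w k` is at most `w j`,
-- while the other copy and `w m` are at most `w i`.
twoHeaviest-bound : ∀ {n} (w : Fin n → ℝ) {i j : Fin n} →
  (∀ k → w k ≤ w i) → (∀ k → k ≢ i → w k ≤ w j) →
  ∀ k m → k ≢ m → 2 · w k + w m ≤ 2 · w i + w j
twoHeaviest-bound w {i} {j} ≤wᵢ ≤wⱼ k m k≢m with k Fin.≟ i
... | yes refl = +-mono-≤ {2 · w k} {2 · w k} {w m} {w j}
                   (≤-refl {2 · w k}) (≤wⱼ m (k≢m ∘ sym))
... | no k≢i = begin
  2 · w k + w m
    ≈⟨ (λ n → solve 2 (λ x y → 2 :· x :+ y := (x :+ y) :+ x) refl
                (seq (w k) n) (seq (w m) n)) ⟩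
  (w k + w m) + w k
    ≲⟨ +-mono-≤ {w k + w m} {w i + w i} {w k} {w j}
         (+-mono-≤ {w k} {w i} {w m} {w i} (≤wᵢ k) (≤wᵢ m)) (≤wⱼ k k≢i) ⟩
  (w i + w i) + w j
    ≈⟨ (λ n → solve 2 (λ x y → (x :+ x) :+ y := 2 :· x :+ y) refl
                (seq (w i) n) (seq (w j) n)) ⟩
  2 · w i + w j ∎

-- The chain `e + (c + p) = s ≤ t + q ≤ c + p` would force `e ≤ 0`. In the application `c` and `t`
-- are the costs of the balanced tree and of a supposed optimal one, `p` and `q` are savings, and
-- `s` is three times the total weight.
suboptimal : ∀ {e c p s t q} → 0ℝ < e → e + (c + p) ≋ s →
  s ≤ t + q → t ≤ c → q ≤ p → ⊥
suboptimal {e} {c} {p} {s} {t} {q} 0<e e+c+p≋s s≤t+q t≤c q≤p =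
  <⇒≱ {0ℝ} {e} 0<e (+-cancelʳ-≤ {e} {0ℝ} (c + p) (begin
    e + (c + p)   ≈⟨ e+c+p≋s ⟩
    s             ≲⟨ s≤t+q ⟩
    t + q         ≲⟨ +-mono-≤ {t} {c} {q} {p} t≤c q≤p ⟩
    c + p         ≈⟨ (λ n → ℚ.+-identityˡ (seq (c + p) n)) ⟨
    0ℝ + (c + p)  ∎))

-- The instance

pattern 0F = zero
pattern 1F = suc zero
pattern 2F = suc (suc zero)
pattern 3F = suc (suc (suc zero))

balanced : 2WCST 4
balanced = record
  { tree     = node (lessThan 2F) (node (lessThan 1F) leaf leaf)
                                  (node (lessThan 3F) leaf leaf)
  ; labels   = mk↔ₛ′
      (λ { (inYes (inYes here)) → 0F ; (inYes (inNo here)) → 1F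
         ; (inNo (inYes here)) → 2F ; (inNo (inNo here)) → 3F })
      (λ { 0F → inYes (inYes here) ; 1F → inYes (inNo here)
         ; 2F → inNo (inYes here) ; 3F → inNo (inNo here) })
      (λ { 0F → refl ; 1F → refl ; 2F → refl ; 3F → refl })
      (λ { (inYes (inYes here)) → refl ; (inYes (inNo here)) → refl
         ; (inNo (inYes here)) → refl ; (inNo (inNo here)) → refl })
  ; searches = λ { 0F → refl ; 1F → refl ; 2F → refl ; 3F → refl }
  }

module Tight (α β ε : ℝ) (β≤α : β ≤ α) (2α+β≈1 : 2 · α + β ≈ 1ℝ)
             (0<ε : 0ℝ < ε) (α+ε≤2/5 : α + ε ≤ fromℚ (+ 2 / 5)) where

  w : Fin 4 → ℝ
  w 0F = α
  w 1F = β - ε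
  w 2F = β - ε
  w 3F = (α - β) + 2 · ε

  0≤ε : 0ℝ ≤ ε
  0≤ε = <⇒≤ {0ℝ} {ε} 0<ε

  w₁≤w₀ : w 1F ≤ w 0F
  w₁≤w₀ = +-cancelʳ-≤ {w 1F} {w 0F} ε (begin
    (β - ε) + ε ≈⟨ (λ n → solve 2 (λ b e → (b :- e) :+ e := b :+ con 0ℚ) refl
                            (seq β n) (seq ε n)) ⟩
    β + 0ℝ      ≲⟨ +-mono-≤ {β} {α} {0ℝ} {ε} β≤α 0≤ε ⟩
    α + ε       ∎)

  -- The claim amounts to `α + 3ε ≤ 2β`. Adding `4α` to both sides makes the right side
  -- `2(2α + β) = 2`, and `5α + 3ε ≤ 5(α + ε) ≤ 2`; this is where the constant `2/5` enters.
  w₃≤w₁ : w 3F ≤ w 1F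
  w₃≤w₁ = +-cancelʳ-≤ {w 3F} {w 1F} ((β + ε) + 4 · α) (begin
    w 3F + ((β + ε) + 4 · α)
      ≈⟨ (λ n → solve 3 (λ a b e → ((a :- b) :+ 2 :· e) :+ ((b :+ e) :+ 4 :· a)
                           := (5 :· a :+ 3 :· e) :+ con 0ℚ) refl
                  (seq α n) (seq β n) (seq ε n)) ⟩
    (5 · α + 3 · ε) + 0ℝ
      ≲⟨ +-mono-≤ {5 · α + 3 · ε} {5 · α + 3 · ε} {0ℝ} {2 · ε}
           (≤-refl {5 · α + 3 · ε}) (·-nonneg {ε} 2 0≤ε) ⟩
    (5 · α + 3 · ε) + 2 · ε
      ≈⟨ (λ n → solve 2 (λ a e → (5 :· a :+ 3 :· e) :+ 2 :· e := 5 :· (a :+ e)) refl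
                  (seq α n) (seq ε n)) ⟩
    5 · (α + ε)
      ≲⟨ ·-monoʳ-≤ {α + ε} {fromℚ (+ 2 / 5)} 5 α+ε≤2/5 ⟩
    5 · fromℚ (+ 2 / 5)
      ≈⟨ (λ _ → refl) ⟩
    2 · 1ℝ
      ≲⟨ ·-monoʳ-≤ {1ℝ} {2 · α + β} 2 (≈⇒≥ {2 · α + β} {1ℝ} 2α+β≈1) ⟩
    2 · (2 · α + β)
      ≈⟨ (λ n → solve 3 (λ a b e → 2 :· (2 :· a :+ b)
                           := (b :- e) :+ ((b :+ e) :+ 4 :· a)) refl
                  (seq α n) (seq β n) (seq ε n)) ⟩
    w 1F + ((β + ε) + 4 · α) ∎)

  0≤w₃ : 0ℝ ≤ w 3F
  0≤w₃ = +-cancelʳ-≤ {0ℝ} {w 3F} β (begin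
    0ℝ + β           ≈⟨ (λ n → ℚ.+-comm 0ℚ (seq β n)) ⟩
    β + 0ℝ           ≲⟨ +-mono-≤ {β} {α} {0ℝ} {2 · ε} β≤α (·-nonneg {ε} 2 0≤ε) ⟩
    α + 2 · ε        ≈⟨ (λ n → solve 3 (λ a b e → a :+ 2 :· e
                                  := ((a :- b) :+ 2 :· e) :+ b) refl
                                 (seq α n) (seq β n) (seq ε n)) ⟩
    w 3F + β         ∎)

  -- The sign of `β - ε` comes from the lightest weight, which is nonnegative because `β ≤ α`.
  0≤w₁ : 0ℝ ≤ w 1F
  0≤w₁ = ≤-trans {0ℝ} {w 3F} {w 1F} 0≤w₃ w₃≤w₁

  w-nonneg : ∀ k → 0ℝ ≤ w k
  w-nonneg 0F = ≤-trans {0ℝ} {w 1F} {w 0F} 0≤w₁ w₁≤w₀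
  w-nonneg 1F = 0≤w₁
  w-nonneg 2F = 0≤w₁
  w-nonneg 3F = 0≤w₃

  w≤w₁ : ∀ k → k ≢ 0F → w k ≤ w 1F
  w≤w₁ 0F 0≢0 = contradiction refl 0≢0
  w≤w₁ 1F _   = ≤-refl {w 1F}
  w≤w₁ 2F _   = ≤-refl {w 1F}
  w≤w₁ 3F _   = w₃≤w₁

  w≤w₀ : ∀ k → w k ≤ w 0F
  w≤w₀ 0F = ≤-refl {w 0F}
  w≤w₀ k@(suc _) = ≤-trans {w k} {w 1F} {w 0F} (w≤w₁ k λ ()) w₁≤w₀

  I : Instance
  I = record { n = 4 ; weight = w ; nonneg = w-nonneg }

  total≈1 : Instance.totalWeight I ≈ 1ℝ
  total≈1 = ≋-≈-trans {sum w} {2 · α + β} {1ℝ}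
    (λ n → solve 3 (λ a b e → a :+ ((b :- e) :+ ((b :- e) :+ (((a :- b) :+ 2 :· e) :+ con 0ℚ)))
                      := 2 :· a :+ b) refl (seq α n) (seq β n) (seq ε n))
    2α+β≈1

  heaviestTwo : HeaviestTwo I α (β - ε)
  heaviestTwo =
    0F , 1F , (λ ()) , ≈-refl {w 0F} , ≈-refl {w 1F} , w≤w₀ , w≤w₁

  -- The balanced tree costs twice the total weight, so the identity says that the total weight is
  -- `ε + (2α + (β - ε))`; both are `2α + β`.
  balanced-cost :
    ε + (cost I balanced + (2 · w 0F + w 1F)) ≋ sum (λ j → 3 · w j)
  balanced-cost n = solve 3
    (λ a b e →
      let c = b :- e
          r = (a :- b) :+ 2 :· e
          twice = 2 :· a :+ (2 :· c :+ (2 :· c :+ (2 :· r :+ con 0ℚ)))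
          thrice = 3 :· a :+ (3 :· c :+ (3 :· c :+ (3 :· r :+ con 0ℚ)))
      in e :+ (twice :+ (2 :· a :+ c)) := thrice)
    refl (seq α n) (seq β n) (seq ε n)

  not-equalTo : (T : 2WCST 4) → Optimal I T → ¬ RootedAtEqualTo (2WCST.tree T)
  not-equalTo T optimal root =
    let k , m , k≢m , bound = equalToRoot-cost w w-nonneg T root in
    suboptimal {ε} {cost I balanced} {2 · w 0F + w 1F} {sum (λ j → 3 · w j)}
               {cost I T} {2 · w k + w m}
      0<ε balanced-cost bound (optimal balanced)
      (twoHeaviest-bound w {0F} {1F} w≤w₀ w≤w₁ k m k≢m)

mainTheorem4 : (α β : ℝ) → α < fromℚ (+ 2 / 5) → β ≤ α → 2 · α + β ≈ 1ℝ →
    ∃ λ (ε₀ : ℝ) → 0ℝ < ε₀ ×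
    ((ε : ℝ) → 0ℝ < ε → ε < ε₀ →
    ∃ λ (I : Instance) →
    Instance.totalWeight I ≈ 1ℝ ×
    HeaviestTwo I α (β - ε) ×
    ((T : 2WCST (Instance.n I)) → Optimal I T → ¬ RootedAtEqualTo (2WCST.tree T)))
mainTheorem4 α β (δ , 0<δ , N , α+δ<2/5) β≤α 2α+β≈1 =
  -- The gap `δ` witnessing `α < 2/5` serves as `ε₀`, since `ε < δ` then gives `α + ε ≤ 2/5`.
  fromℚ δ , 0<fromℚδ , λ ε 0<ε ε<δ →
    let open Tight α β ε β≤α 2α+β≈1 0<ε (α+ε≤2/5 ε ε<δ)
    in I , total≈1 , heaviestTwo , not-equalTo
  where
  0<fromℚδ : 0ℝ < fromℚ δ
  0<fromℚδ with halve δ 0<δ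
  -- Half of `δ` is the gap, as `0 + η < η + η` must be strict.
  ... | η , 0<η , refl = η , 0<η , 0 , λ _ _ → ℚ.+-monoˡ-< η 0<η

  α+ε≤2/5 : ∀ ε → ε < fromℚ δ → α + ε ≤ fromℚ (+ 2 / 5)
  α+ε≤2/5 ε ε<δ =
    ≤-trans {α + ε} {α + fromℚ δ} {fromℚ (+ 2 / 5)}
      (+-mono-≤ {α} {α} {ε} {fromℚ δ} (≤-refl {α}) (<⇒≤ {ε} {fromℚ δ} ε<δ))
      λ η 0<η → N , λ n N≤n →
        ℚ.<-trans (α+δ<2/5 n N≤n) (p<p+q (+ 2 / 5) 0<η)
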